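{- Let ${\bf n}$ be the fixed point starting with $0$ of the morphism $0\mapsto01$, $1\mapsto2$, $2\mapsto0$. For every $m\ge1$, ${\bf n}$ contains an abelian square of order $m$, i.e., a factor $x_1x_2$ with $|x_1|=|x_2|=m$ and $\psi(x_1)=\psi(x_2)$.
   Context: For a word $w$ over $\{0,1,2\}$, its Parikh vector is $\psi(w)=(|w|_0,|w|_1,|w|_2)$, where $|w|_a$ is the number of occurrences of $a$ in $w$. -}

module Defs where

open import Data.Nat using (ℕ; zero; suc; _+_)
open import Data.Fin using (Fin; zero; suc)
open import Data.Fin.Properties using (_≟_)
open import Data.List using (List; []; _∷_; _++_; concatMap; length)
open import Data.Product using (_×_; _,_)
open import Relation.Nullary using (yes; no)
open import Relation.Binary.PropositionalEquality using (_≡_)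

Letter : Set
Letter = Fin 3

φ : Letter → List Letter
φ zero = zero ∷ suc zero ∷ []
φ (suc zero) = suc (suc zero) ∷ []
φ (suc (suc zero)) = zero ∷ []

φ* : List Letter → List Letter
φ* = concatMap φ

iterφ : ℕ → List Letter
iterφ zero = zero ∷ []
iterφ (suc k) = φ* (iterφ k)

at : List Letter → ℕ → Letter
at [] _ = zero
at (x ∷ xs) zero = x
at (x ∷ xs) (suc i) = at xs i

-- The fixed point n = lim φ^k(0) starting with 0.  Since each φ^k(0) is a
-- prefix of φ^(k+1)(0) and |φ^k(0)| ≥ k+1, letter i of n is letter i of φ^(i+1)(0).
nw : ℕ → Letter
nw i = at (iterφ (suc i)) i

factor : (ℕ → Letter) → ℕ → ℕ → List Letter
factor w i zero = []
factor w i (suc m) = w i ∷ factor w (suc i) m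

count : Letter → List Letter → ℕ
count a [] = 0
count a (x ∷ xs) with a ≟ x
... | yes _ = suc (count a xs)
... | no _ = count a xs

ψ : List Letter → ℕ × ℕ × ℕ
ψ u = count zero u , count (suc zero) u , count (suc (suc zero)) u

HasAbelianSquare : (ℕ → Letter) → ℕ → Set
HasAbelianSquare w m =
  Data.Product.∃ λ i → ψ (factor w i m) ≡ ψ (factor w (i + m) m)

{-# OPTIONS --safe #-}
-- An abelian square of order m starting at i is a triple of prefixes, of lengths i, i + m and
-- i + 2m, whose Parikh vectors X, Y, Z satisfy Y − X = Z − Y. Every position of 𝐧 other than 0
-- is reached from a smaller one by applying φ, and a simultaneous choice of such steps for m
-- and for the three prefixes acts on the discrepancies Y − X − p and Z − Y − p, where p is the
-- Parikh vector of the prefix of length m, by a fixed affine map. Hence the small discrepancies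
-- realised for m (with the letters following the three prefixes) are governed by a finite
-- automaton reading the descent of m to 0. A finite table of sets of discrepancies that is
-- closed under its transitions, each set containing a pair of equal discrepancies with
-- coordinate sum 0, therefore gives an abelian square of every order.
module Submission where

open import Defs
open import Data.Fin.Base using (zero; suc)
import Data.Fin.Properties as Fin
open import Data.List.Base using (List; []; _∷_; _++_; length)
open import Data.List.Properties
  using (++-assoc; ++-identityʳ; concatMap-++; length-++; length-++-≤ˡ; ∷-injectiveˡ; ∷-injectiveʳ)
open import Data.List.Membership.DecPropositional (Fin._≟_ {3}) using (_∈?_)
open import Data.List.Membership.Propositional using (_∈_; find; lose)
open import Data.List.Relation.Unary.All as All using (All; []; _∷_; all?; lookupAny)
open import Data.List.Relation.Unary.Any using (Any; here; there; any?)
open import Data.Nat using (ℕ; zero; suc; _+_; _<_; _≤_; _≥_; z≤n; s≤s)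
open import Data.Nat.Properties
open import Data.Nat.Tactic.RingSolver using (solve-∀)
open import Data.Product.Base using (_×_; _,_; ∃-syntax; proj₂)
open import Data.Product.Properties using (≡-dec)
open import Data.Unit.Base using (⊤; tt)
open import Function.Base using (_∘_)
open import Relation.Binary.PropositionalEquality
open import Relation.Nullary.Decidable using (Dec; yes; no; _×-dec_; from-yes)

-- Parikh vectors and the action of the morphism on them.

pattern 𝟎 = zero
pattern 𝟏 = suc zero
pattern 𝟐 = suc (suc zero)

Vec³ : Set
Vec³ = ℕ × ℕ × ℕ

infixl 6 _⊕_

_⊕_ : Vec³ → Vec³ → Vec³
(a , b , c) ⊕ (a′ , b′ , c′) = a + a′ , b + b′ , c + c′

𝟘³ 𝟙³ : Vec³
𝟘³ = 0 , 0 , 0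
𝟙³ = 1 , 1 , 1

sum³ : Vec³ → ℕ
sum³ (a , b , c) = a + b + c

≡³ : ∀ {a b c a′ b′ c′ : ℕ} → a ≡ a′ → b ≡ b′ → c ≡ c′ → (a , b , c) ≡ (a′ , b′ , c′)
≡³ refl refl refl = refl

≡³-projections : ∀ {a b c a′ b′ c′ : ℕ} → (a , b , c) ≡ (a′ , b′ , c′) → a ≡ a′ × b ≡ b′ × c ≡ c′
≡³-projections refl = refl , refl , refl

-- In the images of `φ`, 1 only ever stands second, while 0 and 2 only ever stand first. Hence the
-- offset of a letter inside an image depends on that letter alone.
σ : Letter → ℕ
σ 𝟏 = 1
σ _ = 0

-- The incidence matrix of φ; s is the number of letters of φ a to the left of the position
-- inside it (only the second letter of φ 0 = 01 has s = 1, and the letter skipped is 0).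
M : ℕ → Vec³ → Vec³
M s (a , b , c) = a + c + s , a , b

count-++ : ∀ a u v → count a (u ++ v) ≡ count a u + count a v
count-++ a [] v = refl
count-++ a (x ∷ u) v with a Fin.≟ x
... | yes _ = cong suc (count-++ a u v)
... | no _ = count-++ a u v

ψ-++ : ∀ u v → ψ (u ++ v) ≡ ψ u ⊕ ψ v
ψ-++ u v = ≡³ (count-++ 𝟎 u v) (count-++ 𝟏 u v) (count-++ 𝟐 u v)

sum³-ψ : ∀ u → sum³ (ψ u) ≡ length u
sum³-ψ [] = refl
sum³-ψ (𝟎 ∷ u) = cong suc (sum³-ψ u)
sum³-ψ (𝟏 ∷ u) = trans (cong (_+ count 𝟐 u) (+-suc (count 𝟎 u) (count 𝟏 u))) (cong suc (sum³-ψ u))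
sum³-ψ (𝟐 ∷ u) = trans (+-suc (count 𝟎 u + count 𝟏 u) (count 𝟐 u)) (cong suc (sum³-ψ u))

ψ-φ* : ∀ u → ψ (φ* u) ≡ M 0 (ψ u)
ψ-φ* [] = refl
ψ-φ* (𝟎 ∷ u) with ≡³-projections (ψ-φ* u)
... | e , f , g = ≡³ (cong suc e) (cong suc f) g
ψ-φ* (𝟏 ∷ u) with ≡³-projections (ψ-φ* u)
... | e , f , g = ≡³ e f (cong suc g)
ψ-φ* (𝟐 ∷ u) with ≡³-projections (ψ-φ* u)
... | e , f , g = ≡³ (trans (cong suc e) (cong (_+ 0) (sym (+-suc (count 𝟎 u) (count 𝟐 u))))) f g

-- Positions of the fixed point and their images.

φ*-++ : ∀ u v → φ* (u ++ v) ≡ φ* u ++ φ* v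
φ*-++ = concatMap-++ φ

-- A position of 𝐧, given by the Parikh vector of the prefix before it and the letter standing
-- there.
Occurs : Vec³ → Letter → Set
Occurs p a = ∃[ k ] ∃[ u ] ∃[ v ] (iterφ k ≡ u ++ a ∷ v × ψ u ≡ p)

occurs-image : ∀ {p a} w w′ {b v} → φ a ≡ w ++ b ∷ w′ → v ≡ M 0 p ⊕ ψ w → Occurs p a → Occurs v b
occurs-image {a = a} w w′ {b} eq ev (k , u , v , e , refl) =
  suc k , φ* u ++ w , w′ ++ φ* v , split ,
  trans (ψ-++ (φ* u) w) (trans (cong (_⊕ ψ w) (ψ-φ* u)) (sym ev))
  where
  open ≡-Reasoning
  split : φ* (iterφ k) ≡ (φ* u ++ w) ++ b ∷ w′ ++ φ* v
  split = begin
    φ* (iterφ k)                    ≡⟨ cong φ* e ⟩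
    φ* (u ++ a ∷ v)                 ≡⟨ φ*-++ u (a ∷ v) ⟩
    φ* u ++ φ a ++ φ* v             ≡⟨ cong (λ z → φ* u ++ z ++ φ* v) eq ⟩
    φ* u ++ (w ++ b ∷ w′) ++ φ* v   ≡⟨ cong (φ* u ++_) (++-assoc w (b ∷ w′) (φ* v)) ⟩
    φ* u ++ w ++ b ∷ w′ ++ φ* v     ≡⟨ ++-assoc (φ* u) w _ ⟨
    (φ* u ++ w) ++ b ∷ w′ ++ φ* v   ∎

M-+0 : ∀ p → M 0 p ⊕ 𝟘³ ≡ M 0 p
M-+0 (a , b , c) = ≡³ (+-identityʳ _) (+-identityʳ _) (+-identityʳ _)

occurs-child : ∀ {p a b} → b ∈ φ a → Occurs p a → Occurs (M (σ b) p) b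
occurs-child {p} {𝟎} (here refl) = occurs-image [] _ refl (sym (M-+0 p))
occurs-child {a , b , c} {𝟎} (there (here refl)) =
  occurs-image (𝟎 ∷ []) [] refl
    (≡³ (cong (_+ 1) (sym (+-identityʳ (a + c)))) (sym (+-identityʳ a)) (sym (+-identityʳ b)))
occurs-child {p} {𝟏} (here refl) = occurs-image [] _ refl (sym (M-+0 p))
occurs-child {p} {𝟐} (here refl) = occurs-image [] _ refl (sym (M-+0 p))

-- Discrepancies and their transitions.

-- D₁ and D₂ are the discrepancies Y − X − p and Z − Y − p shifted by 𝟙³, so that their
-- entries −1, 0, 1 become natural numbers.
record Config : Set where
  constructor cfg
  field
    D₁ D₂ : Vec³
    x y z : Letter

open Config

-- The two equations are the definition of the discrepancies with every subtraction moved to the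
-- other side.
record Realised (p : Vec³) (c : Config) : Set where
  constructor realised
  field
    {X Y Z} : Vec³
    X-occurs : Occurs X (x c)
    Y-occurs : Occurs Y (y c)
    Z-occurs : Occurs Z (z c)
    Y≡X : Y ⊕ 𝟙³ ≡ X ⊕ p ⊕ D₁ c
    Z≡Y : Z ⊕ 𝟙³ ≡ Y ⊕ p ⊕ D₂ c

-- The affine map D ↦ M D + (t − s − r, 0, 0) on unshifted discrepancies, where s, t and r are
-- the offsets of X, Y and p; moving everything to the natural numbers leaves the suc.
StepD : (r s t : ℕ) → Vec³ → Vec³ → Set
StepD r s t (d₀ , d₁ , d₂) (d₀′ , d₁′ , d₂′) =
  d₀′ + suc (s + r) ≡ d₀ + d₂ + t × d₁′ ≡ d₀ × d₂′ ≡ d₁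

stepD-sound : ∀ {r s t} p D D′ X Y → StepD r s t D D′ →
              Y ⊕ 𝟙³ ≡ X ⊕ p ⊕ D → M t Y ⊕ 𝟙³ ≡ M s X ⊕ M r p ⊕ D′
stepD-sound {r} {s} {t} (p₀ , p₁ , p₂) (d₀ , d₁ , d₂) (d₀′ , _ , _) (x₀ , x₁ , x₂) (y₀ , y₁ , y₂)
            (h , refl , refl) e with ≡³-projections e
-- `M` copies coordinates 0 and 1 into 1 and 2, so `e₀` and `e₁` serve there unchanged. Coordinate 0
-- adds `e₀` and `e₂`, which carry two shifts where the result carries one.
... | e₀ , e₁ , e₂ = ≡³ (+-cancelʳ-≡ (suc (s + r)) _ _ core) e₀ e₁
  where
  open ≡-Reasoning
  core : y₀ + y₂ + t + 1 + suc (s + r) ≡ (x₀ + x₂ + s) + (p₀ + p₂ + r) + d₀′ + suc (s + r)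
  core = begin
    y₀ + y₂ + t + 1 + suc (s + r)
      ≡⟨ regroup y₀ y₂ t s r ⟩
    (y₀ + 1) + (y₂ + 1) + (t + (s + r))
      ≡⟨ cong₂ (λ m n → m + n + (t + (s + r))) e₀ e₂ ⟩
    (x₀ + p₀ + d₀) + (x₂ + p₂ + d₂) + (t + (s + r))
      ≡⟨ collect x₀ x₂ p₀ p₂ d₀ d₂ t s r ⟩
    (x₀ + x₂ + s) + (p₀ + p₂ + r) + (d₀ + d₂ + t)
      ≡⟨ cong ((x₀ + x₂ + s) + (p₀ + p₂ + r) +_) h ⟨
    (x₀ + x₂ + s) + (p₀ + p₂ + r) + (d₀′ + suc (s + r))
      ≡⟨ +-assoc ((x₀ + x₂ + s) + (p₀ + p₂ + r)) d₀′ _ ⟨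
    (x₀ + x₂ + s) + (p₀ + p₂ + r) + d₀′ + suc (s + r) ∎
    where
    regroup : ∀ a b t s r → a + b + t + 1 + suc (s + r) ≡ (a + 1) + (b + 1) + (t + (s + r))
    regroup = solve-∀
    collect : ∀ a b c d e f t s r → (a + c + e) + (b + d + f) + (t + (s + r)) ≡
              (a + b + s) + (c + d + r) + (e + f + t)
    collect = solve-∀

-- The middle prefix enters twice: its offset `σ y′` raises `D₁` and lowers `D₂`.
Step : Letter → Config → Config → Set
Step b (cfg D₁ D₂ x y z) (cfg D₁′ D₂′ x′ y′ z′) =
  StepD (σ b) (σ x′) (σ y′) D₁ D₁′ × StepD (σ b) (σ y′) (σ z′) D₂ D₂′ ×
  x′ ∈ φ x × y′ ∈ φ y × z′ ∈ φ z

step-sound : ∀ {p b c c′} → Step b c c′ → Realised p c → Realised (M (σ b) p) c′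
step-sound {p} (s₁ , s₂ , x∈ , y∈ , z∈) (realised {X} {Y} {Z} oX oY oZ e₁ e₂) =
  realised (occurs-child x∈ oX) (occurs-child y∈ oY) (occurs-child z∈ oZ)
    (stepD-sound p _ _ X Y s₁ e₁) (stepD-sound p _ _ Y Z s₂ e₂)

stepD? : ∀ r s t D D′ → Dec (StepD r s t D D′)
stepD? r s t (d₀ , d₁ , d₂) (d₀′ , d₁′ , d₂′) =
  d₀′ + suc (s + r) ≟ d₀ + d₂ + t ×-dec d₁′ ≟ d₀ ×-dec d₂′ ≟ d₁

step? : ∀ b c c′ → Dec (Step b c c′)
step? b (cfg D₁ D₂ x y z) (cfg D₁′ D₂′ x′ y′ z′) =
  stepD? (σ b) (σ x′) (σ y′) D₁ D₁′ ×-dec stepD? (σ b) (σ y′) (σ z′) D₂ D₂′ ×-dec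
  x′ ∈? φ x ×-dec y′ ∈? φ y ×-dec z′ ∈? φ z

-- Each target needs a source, but successors may be dropped; this is what allows the sets to be
-- thinned out.
Leads : Letter → List Config → List Config → Set
Leads b cs cs′ = All (λ c′ → Any (λ c → Step b c c′) cs) cs′

leads? : ∀ b cs cs′ → Dec (Leads b cs cs′)
leads? b cs = all? λ c′ → any? (λ c → step? b c c′) cs

leads-sound : ∀ {p b cs cs′} → Leads b cs cs′ →
              All (Realised p) cs → All (Realised (M (σ b) p)) cs′
leads-sound {p} {b} {cs} leads real = All.map from leads
  where
  from : ∀ {c′} → Any (λ c → Step b c c′) cs → Realised (M (σ b) p) c′
  from s with lookupAny real s
  ... | r , st = step-sound {b = b} st r

-- Configurations realised at the empty prefix.

root : Config
root = cfg 𝟙³ 𝟙³ 𝟎 𝟎 𝟎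

root-realised : Realised 𝟘³ root
root-realised = realised o o o refl refl
  where
  o : Occurs 𝟘³ 𝟎
  o = 0 , [] , [] , refl , refl

-- 𝟘³ is its own child along the letter 0, so configurations can be derived from root
-- at 𝟘³ one after the other; the latest derived one comes first.
Chain : List Config → Set
Chain [] = ⊤
Chain (c ∷ cs) = Any (λ c₀ → Step 𝟎 c₀ c) (cs ++ root ∷ []) × Chain cs

chain? : ∀ cs → Dec (Chain cs)
chain? [] = yes tt
chain? (c ∷ cs) = any? (λ c₀ → step? 𝟎 c₀ c) (cs ++ root ∷ []) ×-dec chain? cs

chain-sound : ∀ cs → Chain cs → All (Realised 𝟘³) (cs ++ root ∷ [])
chain-sound [] _ = root-realised ∷ []
chain-sound (c ∷ cs) (s , chain) with chain-sound cs chain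
... | real with lookupAny real s
... | r , st = step-sound {b = 𝟎} st r ∷ real

-- The table of states and its finite verification.

State : Set
State = Letter × List Config

-- Coordinate sum 3 is unshifted sum 0: the prefixes X and Y differ in length by exactly m.
Accepting : Config → Set
Accepting c = D₁ c ≡ D₂ c × sum³ (D₁ c) ≡ 3

accepting? : ∀ c → Dec (Accepting c)
accepting? c = ≡-dec _≟_ (≡-dec _≟_ _≟_) (D₁ c) (D₂ c) ×-dec sum³ (D₁ c) ≟ 3

-- At `𝟘³` the unshifted discrepancies are `Y − X` and `Z − Y` themselves, so these are triples of
-- nearby positions. `root` alone is too little: its steps along `𝟏` reach no accepting
-- configuration.
initial : List Config
initial =
  cfg (1 , 1 , 2) (2 , 1 , 1) 𝟐 𝟎 𝟏 ∷ cfg (1 , 2 , 1) (1 , 1 , 1) 𝟏 𝟎 𝟎 ∷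
  cfg (2 , 1 , 1) (1 , 1 , 1) 𝟎 𝟎 𝟎 ∷ cfg (1 , 1 , 2) (1 , 1 , 1) 𝟐 𝟎 𝟎 ∷
  cfg (1 , 2 , 2) (1 , 1 , 1) 𝟏 𝟎 𝟎 ∷ cfg (2 , 2 , 1) (1 , 1 , 2) 𝟎 𝟐 𝟎 ∷
  cfg (1 , 2 , 1) (1 , 1 , 2) 𝟏 𝟐 𝟎 ∷ cfg (2 , 1 , 1) (1 , 2 , 2) 𝟎 𝟏 𝟎 ∷
  cfg (1 , 2 , 1) (1 , 1 , 1) 𝟏 𝟐 𝟐 ∷ cfg (2 , 2 , 1) (1 , 1 , 1) 𝟎 𝟐 𝟐 ∷
  cfg (2 , 1 , 1) (1 , 2 , 1) 𝟎 𝟏 𝟐 ∷ cfg (1 , 1 , 1) (2 , 2 , 1) 𝟎 𝟎 𝟐 ∷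
  cfg (2 , 1 , 1) (1 , 1 , 1) 𝟎 𝟏 𝟏 ∷ cfg (1 , 1 , 1) (2 , 1 , 1) 𝟎 𝟎 𝟏 ∷ []

-- Found by a computer search: determinise the automaton of realised discrepancies with entries
-- −1, 0, 1, keep inclusion-minimal sets, and discard configurations at random as long as every
-- set still has an accepting one.
table : List State
table =
  (𝟎 , initial ++ root ∷ []) ∷
  (𝟎 ,
    cfg (1 , 1 , 1) (1 , 1 , 1) 𝟎 𝟎 𝟎 ∷ cfg (1 , 1 , 1) (2 , 1 , 1) 𝟎 𝟎 𝟏 ∷
    cfg (1 , 1 , 1) (2 , 2 , 1) 𝟎 𝟎 𝟐 ∷ cfg (1 , 1 , 2) (1 , 1 , 1) 𝟐 𝟎 𝟎 ∷
    cfg (1 , 1 , 2) (2 , 1 , 1) 𝟐 𝟎 𝟏 ∷ cfg (1 , 2 , 1) (1 , 1 , 1) 𝟏 𝟐 𝟐 ∷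
    cfg (1 , 2 , 1) (1 , 1 , 2) 𝟏 𝟐 𝟎 ∷ cfg (1 , 2 , 2) (1 , 1 , 1) 𝟏 𝟎 𝟎 ∷
    cfg (2 , 1 , 1) (1 , 1 , 1) 𝟎 𝟎 𝟎 ∷ cfg (2 , 1 , 1) (1 , 2 , 1) 𝟎 𝟏 𝟐 ∷
    cfg (2 , 1 , 1) (1 , 2 , 2) 𝟎 𝟏 𝟎 ∷ cfg (2 , 2 , 1) (1 , 1 , 1) 𝟎 𝟐 𝟐 ∷
    cfg (2 , 2 , 1) (1 , 1 , 2) 𝟎 𝟐 𝟎 ∷ []) ∷
  (𝟎 ,
    cfg (1 , 1 , 1) (1 , 1 , 1) 𝟎 𝟎 𝟎 ∷ cfg (1 , 1 , 1) (2 , 1 , 1) 𝟎 𝟎 𝟏 ∷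
    cfg (1 , 1 , 1) (2 , 2 , 1) 𝟎 𝟎 𝟐 ∷ cfg (1 , 1 , 2) (1 , 1 , 1) 𝟐 𝟎 𝟎 ∷
    cfg (1 , 1 , 2) (2 , 1 , 1) 𝟐 𝟎 𝟎 ∷ cfg (1 , 2 , 1) (1 , 1 , 1) 𝟏 𝟎 𝟎 ∷
    cfg (1 , 2 , 1) (1 , 1 , 2) 𝟏 𝟐 𝟎 ∷ cfg (1 , 2 , 2) (1 , 1 , 1) 𝟏 𝟎 𝟎 ∷
    cfg (2 , 1 , 1) (1 , 1 , 1) 𝟎 𝟏 𝟏 ∷ cfg (2 , 1 , 1) (1 , 2 , 1) 𝟎 𝟏 𝟐 ∷
    cfg (2 , 1 , 1) (1 , 2 , 2) 𝟎 𝟏 𝟎 ∷ cfg (2 , 2 , 1) (1 , 1 , 1) 𝟎 𝟎 𝟎 ∷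
    cfg (2 , 2 , 1) (1 , 1 , 2) 𝟎 𝟐 𝟎 ∷ []) ∷
  (𝟏 ,
    cfg (0 , 1 , 2) (2 , 1 , 1) 𝟐 𝟎 𝟏 ∷ cfg (1 , 1 , 1) (1 , 1 , 1) 𝟎 𝟎 𝟏 ∷
    cfg (1 , 1 , 1) (1 , 2 , 1) 𝟎 𝟎 𝟐 ∷ cfg (1 , 1 , 2) (1 , 1 , 1) 𝟐 𝟎 𝟏 ∷
    cfg (1 , 2 , 1) (0 , 1 , 2) 𝟎 𝟐 𝟎 ∷ cfg (1 , 2 , 1) (1 , 1 , 2) 𝟎 𝟐 𝟎 ∷
    cfg (1 , 2 , 2) (1 , 1 , 1) 𝟎 𝟎 𝟎 ∷ []) ∷
  (𝟏 ,
    cfg (0 , 1 , 2) (2 , 1 , 1) 𝟐 𝟎 𝟏 ∷ cfg (1 , 1 , 1) (1 , 1 , 1) 𝟎 𝟎 𝟏 ∷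
    cfg (1 , 1 , 1) (1 , 2 , 1) 𝟎 𝟎 𝟎 ∷ cfg (1 , 1 , 2) (1 , 1 , 1) 𝟐 𝟎 𝟏 ∷
    cfg (1 , 2 , 1) (0 , 1 , 2) 𝟎 𝟐 𝟎 ∷ cfg (1 , 2 , 1) (1 , 1 , 2) 𝟎 𝟐 𝟎 ∷
    cfg (1 , 2 , 2) (1 , 1 , 1) 𝟎 𝟎 𝟎 ∷ []) ∷
  (𝟐 ,
    cfg (0 , 1 , 2) (2 , 1 , 1) 𝟏 𝟎 𝟎 ∷ cfg (1 , 1 , 1) (1 , 1 , 1) 𝟎 𝟎 𝟐 ∷
    cfg (1 , 1 , 1) (1 , 1 , 2) 𝟎 𝟎 𝟎 ∷ cfg (1 , 1 , 2) (1 , 0 , 1) 𝟎 𝟎 𝟎 ∷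
    cfg (1 , 1 , 2) (1 , 1 , 1) 𝟏 𝟎 𝟎 ∷ cfg (1 , 1 , 2) (2 , 0 , 1) 𝟎 𝟎 𝟏 ∷
    cfg (1 , 1 , 2) (2 , 1 , 1) 𝟎 𝟎 𝟎 ∷ cfg (2 , 0 , 1) (1 , 2 , 1) 𝟎 𝟏 𝟐 ∷
    cfg (2 , 1 , 1) (1 , 1 , 1) 𝟎 𝟎 𝟐 ∷ []) ∷
  (𝟎 ,
    cfg (1 , 1 , 1) (1 , 1 , 1) 𝟎 𝟎 𝟎 ∷ cfg (1 , 1 , 1) (2 , 1 , 1) 𝟎 𝟎 𝟎 ∷
    cfg (1 , 1 , 1) (2 , 2 , 1) 𝟏 𝟎 𝟎 ∷ cfg (1 , 2 , 1) (1 , 1 , 1) 𝟏 𝟎 𝟎 ∷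
    cfg (2 , 0 , 1) (1 , 2 , 1) 𝟐 𝟏 𝟎 ∷ cfg (2 , 1 , 1) (1 , 1 , 1) 𝟎 𝟏 𝟎 ∷
    cfg (2 , 1 , 1) (1 , 1 , 1) 𝟐 𝟎 𝟎 ∷ cfg (2 , 1 , 1) (1 , 2 , 1) 𝟏 𝟏 𝟎 ∷
    cfg (2 , 1 , 1) (2 , 1 , 0) 𝟎 𝟎 𝟏 ∷ cfg (2 , 1 , 1) (2 , 2 , 0) 𝟎 𝟎 𝟐 ∷
    cfg (2 , 2 , 0) (1 , 1 , 2) 𝟎 𝟐 𝟎 ∷ cfg (2 , 2 , 1) (1 , 1 , 1) 𝟎 𝟎 𝟎 ∷ []) ∷
  (𝟎 ,
    cfg (1 , 1 , 1) (1 , 1 , 1) 𝟎 𝟎 𝟎 ∷ cfg (1 , 1 , 1) (2 , 1 , 1) 𝟎 𝟎 𝟏 ∷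
    cfg (1 , 1 , 1) (2 , 2 , 1) 𝟎 𝟎 𝟎 ∷ cfg (1 , 1 , 2) (1 , 1 , 1) 𝟐 𝟎 𝟎 ∷
    cfg (1 , 1 , 2) (2 , 1 , 1) 𝟐 𝟎 𝟏 ∷ cfg (1 , 2 , 1) (1 , 1 , 1) 𝟏 𝟐 𝟎 ∷
    cfg (1 , 2 , 2) (1 , 1 , 1) 𝟏 𝟎 𝟎 ∷ cfg (2 , 1 , 1) (1 , 1 , 1) 𝟎 𝟏 𝟏 ∷
    cfg (2 , 1 , 1) (1 , 2 , 1) 𝟎 𝟏 𝟎 ∷ cfg (2 , 1 , 1) (1 , 2 , 2) 𝟐 𝟏 𝟎 ∷
    cfg (2 , 2 , 0) (1 , 1 , 2) 𝟎 𝟐 𝟎 ∷ cfg (2 , 2 , 1) (1 , 1 , 1) 𝟎 𝟎 𝟎 ∷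
    cfg (2 , 2 , 1) (1 , 1 , 2) 𝟐 𝟐 𝟎 ∷ []) ∷
  (𝟏 ,
    cfg (0 , 2 , 1) (0 , 2 , 1) 𝟏 𝟎 𝟐 ∷ cfg (0 , 2 , 1) (0 , 2 , 2) 𝟏 𝟎 𝟎 ∷
    cfg (0 , 2 , 2) (1 , 1 , 1) 𝟎 𝟎 𝟎 ∷ cfg (0 , 2 , 2) (2 , 1 , 1) 𝟎 𝟎 𝟏 ∷
    cfg (1 , 1 , 1) (1 , 2 , 1) 𝟎 𝟏 𝟏 ∷ cfg (1 , 2 , 0) (1 , 1 , 2) 𝟎 𝟐 𝟏 ∷
    cfg (1 , 2 , 1) (0 , 1 , 2) 𝟐 𝟐 𝟎 ∷ cfg (1 , 2 , 1) (1 , 1 , 1) 𝟎 𝟎 𝟏 ∷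
    cfg (1 , 2 , 1) (1 , 1 , 2) 𝟐 𝟐 𝟏 ∷ []) ∷
  (𝟏 ,
    cfg (0 , 2 , 2) (2 , 1 , 1) 𝟎 𝟎 𝟏 ∷ cfg (1 , 1 , 1) (1 , 1 , 1) 𝟎 𝟎 𝟏 ∷
    cfg (1 , 1 , 1) (1 , 2 , 1) 𝟎 𝟎 𝟐 ∷ cfg (1 , 1 , 2) (1 , 1 , 1) 𝟐 𝟎 𝟏 ∷
    cfg (1 , 2 , 1) (0 , 1 , 2) 𝟎 𝟐 𝟎 ∷ cfg (1 , 2 , 1) (1 , 1 , 2) 𝟎 𝟐 𝟎 ∷
    cfg (1 , 2 , 2) (1 , 1 , 1) 𝟎 𝟎 𝟎 ∷ []) ∷
  (𝟐 ,
    cfg (0 , 1 , 2) (1 , 1 , 1) 𝟏 𝟎 𝟐 ∷ cfg (0 , 1 , 2) (2 , 1 , 1) 𝟎 𝟎 𝟐 ∷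
    cfg (1 , 0 , 2) (1 , 0 , 2) 𝟐 𝟏 𝟏 ∷ cfg (1 , 0 , 2) (1 , 2 , 1) 𝟏 𝟏 𝟐 ∷
    cfg (1 , 1 , 1) (1 , 1 , 2) 𝟎 𝟐 𝟐 ∷ cfg (1 , 1 , 2) (1 , 0 , 1) 𝟎 𝟎 𝟎 ∷
    cfg (1 , 1 , 2) (1 , 1 , 1) 𝟎 𝟎 𝟐 ∷ cfg (1 , 1 , 2) (2 , 0 , 1) 𝟎 𝟎 𝟏 ∷
    cfg (1 , 1 , 2) (2 , 1 , 1) 𝟎 𝟎 𝟐 ∷ cfg (2 , 0 , 2) (1 , 1 , 1) 𝟎 𝟏 𝟏 ∷
    cfg (2 , 0 , 2) (1 , 2 , 1) 𝟎 𝟏 𝟐 ∷ []) ∷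
  (𝟐 ,
    cfg (0 , 1 , 2) (2 , 1 , 1) 𝟏 𝟎 𝟎 ∷ cfg (1 , 0 , 2) (1 , 2 , 1) 𝟏 𝟏 𝟐 ∷
    cfg (1 , 1 , 1) (1 , 1 , 1) 𝟎 𝟎 𝟐 ∷ cfg (1 , 1 , 1) (1 , 1 , 2) 𝟎 𝟎 𝟎 ∷
    cfg (1 , 1 , 2) (1 , 0 , 1) 𝟎 𝟎 𝟎 ∷ cfg (1 , 1 , 2) (1 , 1 , 1) 𝟏 𝟎 𝟎 ∷
    cfg (1 , 1 , 2) (2 , 0 , 1) 𝟎 𝟎 𝟏 ∷ cfg (1 , 1 , 2) (2 , 1 , 1) 𝟎 𝟎 𝟎 ∷
    cfg (2 , 0 , 2) (1 , 2 , 1) 𝟎 𝟏 𝟐 ∷ cfg (2 , 1 , 1) (1 , 1 , 1) 𝟎 𝟎 𝟐 ∷ []) ∷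
  (𝟎 ,
    cfg (1 , 0 , 1) (1 , 1 , 1) 𝟐 𝟎 𝟎 ∷ cfg (1 , 1 , 1) (1 , 1 , 1) 𝟏 𝟎 𝟎 ∷
    cfg (1 , 1 , 1) (2 , 1 , 1) 𝟎 𝟎 𝟎 ∷ cfg (1 , 1 , 1) (2 , 2 , 0) 𝟏 𝟎 𝟐 ∷
    cfg (1 , 1 , 1) (2 , 2 , 1) 𝟏 𝟎 𝟎 ∷ cfg (2 , 0 , 1) (1 , 2 , 1) 𝟎 𝟏 𝟎 ∷
    cfg (2 , 1 , 0) (1 , 1 , 2) 𝟐 𝟐 𝟎 ∷ cfg (2 , 1 , 1) (1 , 1 , 1) 𝟎 𝟎 𝟎 ∷
    cfg (2 , 1 , 1) (1 , 2 , 1) 𝟏 𝟏 𝟎 ∷ cfg (2 , 1 , 1) (2 , 1 , 0) 𝟎 𝟎 𝟏 ∷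
    cfg (2 , 1 , 1) (2 , 2 , 0) 𝟎 𝟎 𝟐 ∷ cfg (2 , 2 , 0) (1 , 1 , 1) 𝟏 𝟐 𝟐 ∷
    cfg (2 , 2 , 0) (1 , 1 , 2) 𝟏 𝟐 𝟎 ∷ []) ∷
  (𝟎 ,
    cfg (1 , 1 , 1) (1 , 1 , 1) 𝟎 𝟎 𝟎 ∷ cfg (1 , 1 , 1) (2 , 1 , 1) 𝟎 𝟎 𝟎 ∷
    cfg (1 , 1 , 1) (2 , 2 , 1) 𝟏 𝟎 𝟎 ∷ cfg (1 , 2 , 1) (1 , 1 , 1) 𝟏 𝟎 𝟎 ∷
    cfg (2 , 0 , 1) (1 , 2 , 1) 𝟐 𝟏 𝟎 ∷ cfg (2 , 1 , 0) (1 , 1 , 2) 𝟐 𝟐 𝟎 ∷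
    cfg (2 , 1 , 1) (1 , 1 , 1) 𝟎 𝟏 𝟎 ∷ cfg (2 , 1 , 1) (1 , 1 , 1) 𝟐 𝟎 𝟎 ∷
    cfg (2 , 1 , 1) (1 , 2 , 1) 𝟏 𝟏 𝟎 ∷ cfg (2 , 1 , 1) (2 , 1 , 0) 𝟎 𝟎 𝟏 ∷
    cfg (2 , 1 , 1) (2 , 2 , 0) 𝟎 𝟎 𝟐 ∷ cfg (2 , 2 , 0) (1 , 1 , 2) 𝟏 𝟐 𝟎 ∷
    cfg (2 , 2 , 1) (1 , 1 , 1) 𝟎 𝟎 𝟎 ∷ []) ∷
  (𝟎 ,
    cfg (1 , 1 , 1) (1 , 1 , 1) 𝟐 𝟎 𝟎 ∷ cfg (1 , 1 , 1) (2 , 1 , 1) 𝟐 𝟎 𝟏 ∷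
    cfg (1 , 1 , 1) (2 , 2 , 1) 𝟎 𝟎 𝟎 ∷ cfg (1 , 2 , 1) (1 , 1 , 1) 𝟏 𝟎 𝟎 ∷
    cfg (1 , 2 , 1) (1 , 2 , 1) 𝟏 𝟎 𝟐 ∷ cfg (1 , 2 , 1) (2 , 1 , 1) 𝟎 𝟎 𝟎 ∷
    cfg (1 , 2 , 2) (1 , 1 , 1) 𝟐 𝟎 𝟎 ∷ cfg (2 , 1 , 0) (1 , 1 , 1) 𝟎 𝟏 𝟏 ∷
    cfg (2 , 1 , 1) (0 , 2 , 2) 𝟐 𝟏 𝟎 ∷ cfg (2 , 1 , 1) (1 , 1 , 1) 𝟐 𝟏 𝟏 ∷
    cfg (2 , 1 , 1) (1 , 2 , 1) 𝟎 𝟏 𝟎 ∷ cfg (2 , 1 , 1) (1 , 2 , 2) 𝟐 𝟏 𝟎 ∷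
    cfg (2 , 2 , 0) (1 , 1 , 2) 𝟎 𝟐 𝟎 ∷ cfg (2 , 2 , 1) (1 , 1 , 1) 𝟎 𝟎 𝟎 ∷
    cfg (2 , 2 , 1) (1 , 1 , 2) 𝟐 𝟐 𝟎 ∷ []) ∷
  (𝟏 ,
    cfg (0 , 2 , 1) (0 , 2 , 1) 𝟏 𝟎 𝟐 ∷ cfg (0 , 2 , 1) (0 , 2 , 2) 𝟏 𝟎 𝟎 ∷
    cfg (0 , 2 , 1) (2 , 1 , 1) 𝟎 𝟎 𝟏 ∷ cfg (0 , 2 , 2) (1 , 1 , 1) 𝟐 𝟎 𝟎 ∷
    cfg (0 , 2 , 2) (2 , 1 , 1) 𝟐 𝟎 𝟏 ∷ cfg (1 , 1 , 1) (1 , 2 , 1) 𝟎 𝟏 𝟏 ∷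
    cfg (1 , 2 , 0) (1 , 1 , 2) 𝟎 𝟐 𝟏 ∷ cfg (1 , 2 , 1) (0 , 1 , 2) 𝟐 𝟐 𝟎 ∷
    cfg (1 , 2 , 1) (1 , 1 , 1) 𝟎 𝟎 𝟏 ∷ cfg (1 , 2 , 1) (1 , 1 , 2) 𝟐 𝟐 𝟏 ∷ []) ∷
  (𝟎 ,
    cfg (1 , 1 , 1) (1 , 1 , 1) 𝟎 𝟎 𝟎 ∷ cfg (1 , 1 , 1) (2 , 1 , 1) 𝟎 𝟎 𝟏 ∷
    cfg (1 , 1 , 1) (2 , 2 , 1) 𝟎 𝟎 𝟐 ∷ cfg (1 , 1 , 2) (1 , 1 , 1) 𝟐 𝟎 𝟎 ∷
    cfg (1 , 1 , 2) (2 , 1 , 1) 𝟐 𝟎 𝟏 ∷ cfg (1 , 2 , 1) (1 , 1 , 1) 𝟎 𝟐 𝟐 ∷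
    cfg (1 , 2 , 1) (1 , 1 , 2) 𝟏 𝟐 𝟎 ∷ cfg (1 , 2 , 2) (1 , 1 , 1) 𝟏 𝟎 𝟎 ∷
    cfg (2 , 1 , 1) (1 , 1 , 1) 𝟎 𝟏 𝟏 ∷ cfg (2 , 1 , 1) (1 , 2 , 1) 𝟎 𝟏 𝟐 ∷
    cfg (2 , 1 , 1) (1 , 2 , 2) 𝟎 𝟏 𝟎 ∷ cfg (2 , 2 , 1) (1 , 1 , 1) 𝟎 𝟐 𝟐 ∷
    cfg (2 , 2 , 1) (1 , 1 , 2) 𝟎 𝟐 𝟎 ∷ []) ∷
  (𝟏 ,
    cfg (0 , 1 , 2) (0 , 1 , 2) 𝟐 𝟎 𝟎 ∷ cfg (0 , 2 , 2) (2 , 1 , 1) 𝟎 𝟎 𝟏 ∷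
    cfg (1 , 1 , 2) (0 , 2 , 1) 𝟎 𝟏 𝟎 ∷ cfg (1 , 1 , 2) (1 , 1 , 1) 𝟎 𝟎 𝟏 ∷
    cfg (1 , 1 , 2) (1 , 2 , 1) 𝟎 𝟏 𝟏 ∷ cfg (1 , 2 , 1) (0 , 1 , 2) 𝟎 𝟐 𝟎 ∷
    cfg (1 , 2 , 1) (1 , 0 , 2) 𝟎 𝟐 𝟏 ∷ cfg (1 , 2 , 1) (1 , 1 , 2) 𝟎 𝟐 𝟎 ∷
    cfg (1 , 2 , 2) (1 , 1 , 1) 𝟎 𝟎 𝟎 ∷ []) ∷
  (𝟐 ,
    cfg (0 , 1 , 2) (1 , 1 , 1) 𝟏 𝟎 𝟐 ∷ cfg (0 , 1 , 2) (2 , 1 , 1) 𝟎 𝟎 𝟐 ∷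
    cfg (1 , 0 , 2) (1 , 0 , 2) 𝟐 𝟏 𝟏 ∷ cfg (1 , 0 , 2) (1 , 2 , 1) 𝟎 𝟏 𝟐 ∷
    cfg (1 , 1 , 1) (1 , 1 , 2) 𝟎 𝟐 𝟐 ∷ cfg (1 , 1 , 2) (1 , 0 , 1) 𝟎 𝟎 𝟎 ∷
    cfg (1 , 1 , 2) (1 , 1 , 1) 𝟎 𝟎 𝟐 ∷ cfg (1 , 1 , 2) (2 , 0 , 1) 𝟎 𝟎 𝟏 ∷
    cfg (1 , 1 , 2) (2 , 1 , 1) 𝟎 𝟎 𝟐 ∷ cfg (2 , 0 , 2) (1 , 1 , 1) 𝟎 𝟏 𝟏 ∷
    cfg (2 , 0 , 2) (1 , 2 , 1) 𝟎 𝟏 𝟐 ∷ []) ∷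
  (𝟎 ,
    cfg (1 , 1 , 1) (1 , 1 , 1) 𝟎 𝟎 𝟎 ∷ cfg (1 , 1 , 1) (2 , 1 , 1) 𝟎 𝟎 𝟏 ∷
    cfg (1 , 1 , 1) (2 , 2 , 1) 𝟎 𝟎 𝟐 ∷ cfg (1 , 1 , 2) (1 , 1 , 1) 𝟎 𝟎 𝟎 ∷
    cfg (1 , 1 , 2) (2 , 1 , 1) 𝟐 𝟎 𝟎 ∷ cfg (1 , 2 , 1) (1 , 1 , 1) 𝟏 𝟐 𝟐 ∷
    cfg (1 , 2 , 1) (1 , 1 , 2) 𝟏 𝟐 𝟎 ∷ cfg (1 , 2 , 2) (1 , 1 , 1) 𝟏 𝟎 𝟎 ∷
    cfg (2 , 1 , 1) (1 , 1 , 1) 𝟎 𝟎 𝟎 ∷ cfg (2 , 1 , 1) (1 , 2 , 1) 𝟎 𝟏 𝟐 ∷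
    cfg (2 , 1 , 1) (1 , 2 , 2) 𝟎 𝟏 𝟎 ∷ cfg (2 , 2 , 1) (1 , 1 , 1) 𝟎 𝟐 𝟐 ∷
    cfg (2 , 2 , 1) (1 , 1 , 2) 𝟎 𝟐 𝟎 ∷ []) ∷
  (𝟐 ,
    cfg (0 , 1 , 2) (2 , 1 , 1) 𝟏 𝟎 𝟎 ∷ cfg (1 , 0 , 2) (1 , 2 , 1) 𝟏 𝟏 𝟐 ∷
    cfg (1 , 1 , 1) (1 , 0 , 2) 𝟏 𝟐 𝟏 ∷ cfg (1 , 1 , 1) (1 , 1 , 1) 𝟏 𝟎 𝟐 ∷
    cfg (1 , 1 , 1) (1 , 1 , 2) 𝟏 𝟐 𝟐 ∷ cfg (1 , 1 , 2) (1 , 0 , 1) 𝟎 𝟎 𝟎 ∷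
    cfg (1 , 1 , 2) (1 , 1 , 1) 𝟏 𝟎 𝟎 ∷ cfg (1 , 1 , 2) (2 , 0 , 1) 𝟎 𝟎 𝟏 ∷
    cfg (1 , 1 , 2) (2 , 1 , 0) 𝟎 𝟎 𝟐 ∷ cfg (1 , 1 , 2) (2 , 1 , 1) 𝟎 𝟎 𝟎 ∷
    cfg (2 , 0 , 2) (1 , 2 , 1) 𝟎 𝟏 𝟐 ∷ cfg (2 , 1 , 1) (1 , 1 , 1) 𝟎 𝟎 𝟐 ∷ []) ∷
  (𝟎 ,
    cfg (1 , 0 , 1) (1 , 1 , 1) 𝟐 𝟎 𝟎 ∷ cfg (1 , 1 , 1) (1 , 1 , 1) 𝟏 𝟎 𝟎 ∷
    cfg (1 , 1 , 1) (2 , 1 , 1) 𝟎 𝟎 𝟎 ∷ cfg (1 , 1 , 1) (2 , 2 , 0) 𝟏 𝟎 𝟐 ∷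
    cfg (1 , 1 , 1) (2 , 2 , 1) 𝟏 𝟎 𝟎 ∷ cfg (2 , 0 , 1) (1 , 2 , 1) 𝟎 𝟏 𝟎 ∷
    cfg (2 , 1 , 0) (1 , 1 , 2) 𝟎 𝟐 𝟎 ∷ cfg (2 , 1 , 1) (1 , 1 , 1) 𝟎 𝟎 𝟎 ∷
    cfg (2 , 1 , 1) (1 , 2 , 1) 𝟏 𝟏 𝟎 ∷ cfg (2 , 1 , 1) (2 , 1 , 0) 𝟎 𝟎 𝟏 ∷
    cfg (2 , 1 , 1) (2 , 2 , 0) 𝟎 𝟎 𝟐 ∷ cfg (2 , 2 , 0) (1 , 1 , 1) 𝟏 𝟐 𝟐 ∷
    cfg (2 , 2 , 0) (1 , 1 , 2) 𝟏 𝟐 𝟎 ∷ []) ∷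
  (𝟎 ,
    cfg (1 , 1 , 1) (1 , 1 , 1) 𝟐 𝟎 𝟎 ∷ cfg (1 , 1 , 1) (2 , 1 , 0) 𝟐 𝟎 𝟐 ∷
    cfg (1 , 1 , 1) (2 , 1 , 1) 𝟐 𝟎 𝟎 ∷ cfg (1 , 1 , 1) (2 , 2 , 1) 𝟏 𝟎 𝟎 ∷
    cfg (1 , 2 , 1) (1 , 1 , 1) 𝟏 𝟎 𝟎 ∷ cfg (2 , 0 , 1) (1 , 2 , 1) 𝟐 𝟏 𝟎 ∷
    cfg (2 , 1 , 0) (1 , 1 , 2) 𝟐 𝟐 𝟎 ∷ cfg (2 , 1 , 1) (1 , 1 , 1) 𝟐 𝟎 𝟎 ∷
    cfg (2 , 1 , 1) (1 , 2 , 1) 𝟎 𝟎 𝟎 ∷ cfg (2 , 1 , 1) (1 , 2 , 1) 𝟏 𝟏 𝟎 ∷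
    cfg (2 , 1 , 1) (2 , 1 , 0) 𝟎 𝟎 𝟏 ∷ cfg (2 , 1 , 1) (2 , 2 , 0) 𝟎 𝟎 𝟐 ∷
    cfg (2 , 2 , 0) (1 , 1 , 2) 𝟏 𝟐 𝟎 ∷ cfg (2 , 2 , 1) (1 , 1 , 1) 𝟎 𝟎 𝟎 ∷ []) ∷
  (𝟎 ,
    cfg (1 , 1 , 1) (1 , 1 , 1) 𝟎 𝟎 𝟎 ∷ cfg (1 , 1 , 1) (1 , 2 , 1) 𝟎 𝟎 𝟎 ∷
    cfg (1 , 1 , 1) (2 , 1 , 1) 𝟎 𝟎 𝟏 ∷ cfg (1 , 1 , 1) (2 , 2 , 1) 𝟎 𝟎 𝟎 ∷
    cfg (1 , 1 , 2) (1 , 1 , 1) 𝟐 𝟎 𝟎 ∷ cfg (1 , 1 , 2) (2 , 1 , 1) 𝟐 𝟎 𝟏 ∷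
    cfg (1 , 2 , 1) (1 , 1 , 2) 𝟏 𝟎 𝟎 ∷ cfg (1 , 2 , 2) (1 , 1 , 1) 𝟏 𝟎 𝟎 ∷
    cfg (2 , 1 , 1) (1 , 1 , 1) 𝟎 𝟏 𝟏 ∷ cfg (2 , 1 , 1) (1 , 2 , 1) 𝟎 𝟏 𝟎 ∷
    cfg (2 , 1 , 1) (1 , 2 , 2) 𝟐 𝟏 𝟎 ∷ cfg (2 , 2 , 1) (1 , 1 , 1) 𝟎 𝟎 𝟎 ∷
    cfg (2 , 2 , 1) (1 , 1 , 2) 𝟐 𝟐 𝟎 ∷ []) ∷
  (𝟎 ,
    cfg (1 , 1 , 1) (1 , 1 , 1) 𝟎 𝟎 𝟎 ∷ cfg (1 , 1 , 1) (1 , 1 , 2) 𝟎 𝟎 𝟎 ∷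
    cfg (1 , 1 , 1) (2 , 1 , 1) 𝟎 𝟎 𝟏 ∷ cfg (1 , 1 , 1) (2 , 2 , 1) 𝟎 𝟎 𝟐 ∷
    cfg (1 , 1 , 2) (2 , 1 , 1) 𝟐 𝟎 𝟎 ∷ cfg (1 , 2 , 1) (1 , 1 , 1) 𝟏 𝟐 𝟐 ∷
    cfg (1 , 2 , 1) (1 , 1 , 2) 𝟏 𝟐 𝟎 ∷ cfg (1 , 2 , 2) (1 , 1 , 1) 𝟏 𝟎 𝟎 ∷
    cfg (2 , 1 , 1) (1 , 1 , 1) 𝟎 𝟎 𝟎 ∷ cfg (2 , 1 , 1) (1 , 2 , 1) 𝟎 𝟏 𝟐 ∷
    cfg (2 , 1 , 1) (1 , 2 , 2) 𝟎 𝟏 𝟎 ∷ cfg (2 , 2 , 1) (1 , 1 , 1) 𝟎 𝟐 𝟐 ∷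
    cfg (2 , 2 , 1) (1 , 1 , 2) 𝟎 𝟐 𝟎 ∷ []) ∷
  (𝟏 ,
    cfg (0 , 1 , 2) (2 , 1 , 1) 𝟐 𝟎 𝟏 ∷ cfg (1 , 1 , 1) (1 , 1 , 1) 𝟎 𝟏 𝟏 ∷
    cfg (1 , 1 , 1) (1 , 2 , 1) 𝟎 𝟎 𝟎 ∷ cfg (1 , 1 , 2) (1 , 1 , 1) 𝟐 𝟎 𝟏 ∷
    cfg (1 , 2 , 1) (0 , 1 , 2) 𝟎 𝟐 𝟎 ∷ cfg (1 , 2 , 1) (1 , 1 , 2) 𝟎 𝟐 𝟎 ∷
    cfg (1 , 2 , 2) (1 , 1 , 1) 𝟎 𝟎 𝟎 ∷ []) ∷
  (𝟐 ,
    cfg (0 , 1 , 2) (2 , 1 , 1) 𝟏 𝟎 𝟎 ∷ cfg (1 , 1 , 1) (1 , 1 , 1) 𝟎 𝟐 𝟐 ∷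
    cfg (1 , 1 , 1) (1 , 1 , 2) 𝟎 𝟎 𝟎 ∷ cfg (1 , 1 , 2) (1 , 0 , 1) 𝟎 𝟎 𝟎 ∷
    cfg (1 , 1 , 2) (1 , 1 , 1) 𝟏 𝟎 𝟎 ∷ cfg (1 , 1 , 2) (2 , 0 , 1) 𝟎 𝟎 𝟏 ∷
    cfg (1 , 1 , 2) (2 , 1 , 1) 𝟎 𝟎 𝟎 ∷ cfg (2 , 0 , 1) (1 , 2 , 1) 𝟎 𝟏 𝟐 ∷
    cfg (2 , 1 , 1) (1 , 1 , 1) 𝟎 𝟎 𝟐 ∷ []) ∷ []

Closed : State → Set
Closed (a , cs) = All (λ b → Any (λ (b′ , cs′) → b′ ≡ b × Leads b cs cs′) table) (φ a)

closed? : ∀ s → Dec (Closed s)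
closed? (a , cs) =
  all? (λ b → any? (λ (b′ , cs′) → b′ Fin.≟ b ×-dec leads? b cs cs′) table) (φ a)

opaque
  initial-chain : Chain initial
  initial-chain = from-yes (chain? initial)

  table-closed : All Closed table
  table-closed = from-yes (all? closed? table)

  table-accepting : All (Any Accepting ∘ proj₂) table
  table-accepting = from-yes (all? (any? accepting? ∘ proj₂) table)

-- Desubstitution, and a state for every prefix.

-- Converse of `occurs-child`: images of letters are peeled off the front until the one containing
-- `b` is reached.
desubstitute : ∀ w {u b v} → φ* w ≡ u ++ b ∷ v →
               ∃[ w₁ ] ∃[ a ] ∃[ w₂ ] (w ≡ w₁ ++ a ∷ w₂ × b ∈ φ a × ψ u ≡ M (σ b) (ψ w₁))
desubstitute [] {[]} ()
desubstitute [] {_ ∷ _} ()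
desubstitute (𝟎 ∷ w) {[]} refl = [] , 𝟎 , w , refl , here refl , refl
-- Here `b` is the second letter of `φ 𝟎`; the 0 skipped before it is the offset `σ 𝟏`.
desubstitute (𝟎 ∷ w) {_ ∷ []} refl = [] , 𝟎 , w , refl , there (here refl) , refl
desubstitute (𝟎 ∷ w) {_ ∷ _ ∷ u} e with refl ← ∷-injectiveˡ e | refl ← ∷-injectiveˡ (∷-injectiveʳ e)
  with desubstitute w {u} (∷-injectiveʳ (∷-injectiveʳ e))
... | w₁ , a , w₂ , ew , b∈ , eψ with ≡³-projections eψ
... | e₀ , e₁ , e₂ = 𝟎 ∷ w₁ , a , w₂ , cong (𝟎 ∷_) ew , b∈ , ≡³ (cong suc e₀) (cong suc e₁) e₂
desubstitute (𝟏 ∷ w) {[]} refl = [] , 𝟏 , w , refl , here refl , refl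
desubstitute (𝟏 ∷ w) {_ ∷ u} e with refl ← ∷-injectiveˡ e
  with desubstitute w {u} (∷-injectiveʳ e)
... | w₁ , a , w₂ , ew , b∈ , eψ with ≡³-projections eψ
... | e₀ , e₁ , e₂ = 𝟏 ∷ w₁ , a , w₂ , cong (𝟏 ∷_) ew , b∈ , ≡³ e₀ e₁ (cong suc e₂)
desubstitute (𝟐 ∷ w) {[]} refl = [] , 𝟐 , w , refl , here refl , refl
desubstitute (𝟐 ∷ w) {_ ∷ u} {b} e with refl ← ∷-injectiveˡ e
  with desubstitute w {u} (∷-injectiveʳ e)
... | w₁ , a , w₂ , ew , b∈ , eψ with ≡³-projections eψ
... | e₀ , e₁ , e₂ =
  𝟐 ∷ w₁ , a , w₂ , cong (𝟐 ∷_) ew , b∈ ,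
  ≡³ (trans (cong suc e₀) (cong (_+ σ b) (sym (+-suc (count 𝟎 w₁) (count 𝟐 w₁))))) e₁ e₂

Covers : Vec³ → Letter → State → Set
Covers p a (b , cs) = b ≡ a × All (Realised p) cs

-- Induction on `k` rather than on the length of `u`, because the empty prefix is its own parent.
-- Desubstitution gives the parent, and closure of the table carries its state forward.
covered : ∀ k {u a v} → iterφ k ≡ u ++ a ∷ v → Any (λ s → Covers (ψ u) a s) table
covered zero {[]} refl =
  -- The first state of the table lists exactly the configurations derived at `𝟘³`.
  here (refl , chain-sound initial initial-chain)
covered zero {_ ∷ []} ()
covered zero {_ ∷ _ ∷ _} ()
covered (suc k) {u} {b} e with desubstitute (iterφ k) e
... | w₁ , a , w₂ , e′ , b∈ , eψ with find (covered k {w₁} e′)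
... | (_ , cs) , s∈ , refl , real with find (All.lookup (All.lookup table-closed s∈) b∈)
... | (_ , cs′) , t∈ , refl , leads =
  lose t∈ (refl , subst (λ p → All (Realised p) cs′) (sym eψ) (leads-sound leads real))

-- The iterates as prefixes of 𝐧.

-- No letter has an empty image, so `φ*` keeps a proper extension proper.
iterφ-extends : ∀ k → ∃[ a ] ∃[ t ] iterφ (suc k) ≡ iterφ k ++ a ∷ t
iterφ-extends zero = 𝟏 , [] , refl
iterφ-extends (suc k) with iterφ-extends k
... | a , t , e with φ a in eφ | trans (cong φ* e) (φ*-++ (iterφ k) (a ∷ t))
iterφ-extends (suc k) | 𝟎 , t , e | b ∷ w | e′ = b , w ++ φ* t , e′
iterφ-extends (suc k) | 𝟏 , t , e | b ∷ w | e′ = b , w ++ φ* t , e′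
iterφ-extends (suc k) | 𝟐 , t , e | b ∷ w | e′ = b , w ++ φ* t , e′

iterφ-prefix : ∀ d k → ∃[ t ] iterφ (d + k) ≡ iterφ k ++ t
iterφ-prefix zero k = [] , sym (++-identityʳ (iterφ k))
iterφ-prefix (suc d) k with iterφ-prefix d k | iterφ-extends (d + k)
... | t , e | a , t′ , e′ =
  t ++ a ∷ t′ , trans e′ (trans (cong (_++ a ∷ t′) e) (++-assoc (iterφ k) t (a ∷ t′)))

<-length-iterφ : ∀ k → k < length (iterφ k)
<-length-iterφ zero = s≤s z≤n
<-length-iterφ (suc k) with iterφ-extends k
... | a , t , e = begin-strict
  suc k                              ≤⟨ <-length-iterφ k ⟩
  length (iterφ k)                   <⟨ m<m+n (length (iterφ k)) (s≤s z≤n) ⟩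
  length (iterφ k) + suc (length t)  ≡⟨ length-++ (iterφ k) ⟨
  length (iterφ k ++ a ∷ t)          ≡⟨ cong length e ⟨
  length (iterφ (suc k))             ∎
  where open ≤-Reasoning

at-++ˡ : ∀ u {v i} → i < length u → at (u ++ v) i ≡ at u i
at-++ˡ (_ ∷ _) {i = zero} _ = refl
at-++ˡ (_ ∷ u) {i = suc i} (s≤s i<) = at-++ˡ u i<

-- Both words are prefixes of `iterφ (j + k)`.
at-iterφ : ∀ j k {i} → i < length (iterφ j) → i < length (iterφ k) → at (iterφ j) i ≡ at (iterφ k) i
at-iterφ j k {i} i<j i<k with iterφ-prefix k j | iterφ-prefix j k
... | t , e | t′ , e′ = begin
  at (iterφ j) i        ≡⟨ at-++ˡ (iterφ j) i<j ⟨
  at (iterφ j ++ t) i   ≡⟨ cong (λ w → at w i) e ⟨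
  at (iterφ (k + j)) i  ≡⟨ cong (λ n → at (iterφ n) i) (+-comm k j) ⟩
  at (iterφ (j + k)) i  ≡⟨ cong (λ w → at w i) e′ ⟩
  at (iterφ k ++ t′) i  ≡⟨ at-++ˡ (iterφ k) i<k ⟩
  at (iterφ k) i        ∎
  where open ≡-Reasoning

factor-at : ∀ w i u → (∀ {j} → j < length u → w (i + j) ≡ at u j) → factor w i (length u) ≡ u
factor-at w i [] h = refl
factor-at w i (a ∷ u) h = cong₂ _∷_
  (trans (cong w (sym (+-identityʳ i))) (h (s≤s z≤n)))
  (factor-at w (suc i) u λ {j} j< → trans (cong w (sym (+-suc i j))) (h (s≤s j<)))

factor-+ : ∀ w i m n → factor w i (m + n) ≡ factor w i m ++ factor w (i + m) n
factor-+ w i zero n = cong (λ j → factor w j n) (sym (+-identityʳ i))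
factor-+ w i (suc m) n = cong (w i ∷_)
  (trans (factor-+ w (suc i) m n)
         (cong (λ j → factor w (suc i) m ++ factor w j n) (sym (+-suc i m))))

prefix-nw : ∀ k u {v} → iterφ k ≡ u ++ v → factor nw 0 (length u) ≡ u
prefix-nw k u {v} e = factor-at nw 0 u λ {j} j<u →
  let j<k = <-≤-trans j<u (subst (λ w → length u ≤ length w) (sym e) (length-++-≤ˡ u))
      -- `nw j` is read off `iterφ (suc j)`, which has more than `suc j` letters.
      j<  = <-trans (n<1+n j) (<-length-iterφ (suc j))
  in trans (at-iterφ (suc j) k j< j<k) (trans (cong (λ w → at w j) e) (at-++ˡ u j<u))

occurs-prefix : ∀ {p a} → Occurs p a → ψ (factor nw 0 (sum³ p)) ≡ p
occurs-prefix (k , u , v , e , refl) =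
  cong ψ (trans (cong (factor nw 0) (sum³-ψ u)) (prefix-nw k u e))

-- From accepting configurations to abelian squares.

split-at : ∀ m (w : List Letter) → m < length w → ∃[ u ] ∃[ a ] ∃[ v ] (w ≡ u ++ a ∷ v × length u ≡ m)
split-at zero (a ∷ w) _ = [] , a , w , refl , refl
split-at (suc m) (b ∷ w) (s≤s m<) with split-at m w m<
... | u , a , v , e , l = b ∷ u , a , v , cong (b ∷_) e , cong suc l

sum³-⊕ : ∀ p q → sum³ (p ⊕ q) ≡ sum³ p + sum³ q
sum³-⊕ (a , b , c) (a′ , b′ , c′) = interchange a b c a′ b′ c′
  where
  interchange : ∀ a b c a′ b′ c′ → a + a′ + (b + b′) + (c + c′) ≡ a + b + c + (a′ + b′ + c′)
  interchange = solve-∀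

-- In coordinate sums the 3 of `D` cancels the 3 of `𝟙³`.
sum³-shift : ∀ {X Y p D} → sum³ D ≡ 3 → Y ⊕ 𝟙³ ≡ X ⊕ p ⊕ D → sum³ Y ≡ sum³ X + sum³ p
sum³-shift {X} {Y} {p} {D} d e = +-cancelʳ-≡ 3 _ _ (begin
  sum³ Y + 3                 ≡⟨ sum³-⊕ Y 𝟙³ ⟨
  sum³ (Y ⊕ 𝟙³)              ≡⟨ cong sum³ e ⟩
  sum³ (X ⊕ p ⊕ D)           ≡⟨ sum³-⊕ (X ⊕ p) D ⟩
  sum³ (X ⊕ p) + sum³ D      ≡⟨ cong₂ _+_ (sum³-⊕ X p) d ⟩
  sum³ X + sum³ p + 3        ∎)
  where open ≡-Reasoning

⊕-assoc : ∀ p q r → p ⊕ q ⊕ r ≡ p ⊕ (q ⊕ r)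
⊕-assoc (a , b , c) (a′ , b′ , c′) (a″ , b″ , c″) =
  ≡³ (+-assoc a a′ a″) (+-assoc b b′ b″) (+-assoc c c′ c″)

⊕-cancelˡ : ∀ p {q r} → p ⊕ q ≡ p ⊕ r → q ≡ r
⊕-cancelˡ (a , b , c) e with ≡³-projections e
... | e₀ , e₁ , e₂ = ≡³ (+-cancelˡ-≡ a _ _ e₀) (+-cancelˡ-≡ b _ _ e₁) (+-cancelˡ-≡ c _ _ e₂)

⊕-cancelʳ : ∀ {q r} p → q ⊕ p ≡ r ⊕ p → q ≡ r
⊕-cancelʳ (a , b , c) e with ≡³-projections e
... | e₀ , e₁ , e₂ = ≡³ (+-cancelʳ-≡ a _ _ e₀) (+-cancelʳ-≡ b _ _ e₁) (+-cancelʳ-≡ c _ _ e₂)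

-- The prefix with vector `Y` is the prefix with vector `X` followed by the factor, whose vector is
-- therefore `Y − X`.
ψ-factor : ∀ {X Y p D a b} → Occurs X a → Occurs Y b → sum³ D ≡ 3 → Y ⊕ 𝟙³ ≡ X ⊕ p ⊕ D →
           ψ (factor nw (sum³ X) (sum³ p)) ⊕ 𝟙³ ≡ p ⊕ D
ψ-factor {X} {Y} {p} {D} oX oY d e = ⊕-cancelˡ X (begin
  X ⊕ (ψ f ⊕ 𝟙³)                              ≡⟨ ⊕-assoc X (ψ f) 𝟙³ ⟨
  X ⊕ ψ f ⊕ 𝟙³                                ≡⟨ cong (λ q → q ⊕ ψ f ⊕ 𝟙³) (occurs-prefix oX) ⟨
  ψ (factor nw 0 (sum³ X)) ⊕ ψ f ⊕ 𝟙³         ≡⟨ cong (_⊕ 𝟙³) (ψ-++ (factor nw 0 (sum³ X)) f) ⟨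
  ψ (factor nw 0 (sum³ X) ++ f) ⊕ 𝟙³          ≡⟨ cong (λ w → ψ w ⊕ 𝟙³) (factor-+ nw 0 (sum³ X) (sum³ p)) ⟨
  ψ (factor nw 0 (sum³ X + sum³ p)) ⊕ 𝟙³      ≡⟨ cong (λ n → ψ (factor nw 0 n) ⊕ 𝟙³) (sum³-shift {X} {Y} d e) ⟨
  ψ (factor nw 0 (sum³ Y)) ⊕ 𝟙³               ≡⟨ cong (_⊕ 𝟙³) (occurs-prefix oY) ⟩
  Y ⊕ 𝟙³                                      ≡⟨ e ⟩
  X ⊕ p ⊕ D                                   ≡⟨ ⊕-assoc X p D ⟩
  X ⊕ (p ⊕ D)                                 ∎)
  where
  open ≡-Reasoning
  f = factor nw (sum³ X) (sum³ p)

-- Both halves have the same shifted vector `p ⊕ D`. Only equality of the two discrepancies matters,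
-- so the common vector may differ from `p`.
accepting-square : ∀ {p c} → Accepting c → Realised p c → HasAbelianSquare nw (sum³ p)
accepting-square {p} {cfg D D _ _ _} (refl , d) (realised {X} {Y} {Z} oX oY oZ e₁ e₂) =
  sum³ X , ⊕-cancelʳ 𝟙³ (begin
    ψ (factor nw (sum³ X) m) ⊕ 𝟙³      ≡⟨ ψ-factor oX oY d e₁ ⟩
    p ⊕ D                              ≡⟨ ψ-factor oY oZ d e₂ ⟨
    ψ (factor nw (sum³ Y) m) ⊕ 𝟙³      ≡⟨ cong (λ i → ψ (factor nw i m) ⊕ 𝟙³) (sum³-shift {X} {Y} d e₁) ⟩
    ψ (factor nw (sum³ X + m) m) ⊕ 𝟙³  ∎)
  where
  open ≡-Reasoning
  m = sum³ p

theorem28 : (m : ℕ) → m ≥ 1 → HasAbelianSquare nw m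
-- `iterφ m` has more than `m` letters, so its prefix `u` of length `m` is followed by a letter, as
-- `covered` requires.
theorem28 m _ with split-at m (iterφ m) (<-length-iterφ m)
... | u , a , v , e , refl with find (covered m {u} e)
... | s , s∈ , _ , real with lookupAny real (All.lookup table-accepting s∈)
... | r , acc = subst (HasAbelianSquare nw) (sum³-ψ u) (accepting-square acc r)
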